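{- Let $K$ be an infinite field with $\mathrm{char}(K)=2$, let $Q\in\mathcal{Q}(n,d,m)$, and let $h$ be a closed path in $Q$ with $h\not\equiv0$. Then $\deg(h)\leq 2m(d-n)+m$.
   Context: A quiver $Q$ is a finite oriented graph; for an arrow $a$, $a''$ is its tail and $a'$ its head. A path $a=a_1\cdots a_s$ ($a_i$ arrows) satisfies $a_i'=a_{i+1}''$; it is closed (in the vertex $a_1''$) if $a_1''=a_s'$; $\deg(a)=s$, $V(a)=\{a_1'',a_1',\dots,a_s'\}$. A closed path is primitive if each vertex of $V(a)$ is the head of exactly one $a_i$. $m(Q)$ is the maximal degree of a primitive closed path; $Q$ is strongly connected if some closed path contains all vertices; $\mathcal{Q}(n,d,m)$ is the set of strongly connected quivers with $n$ vertices, $d$ arrows and $m(Q)=m$. Closed paths are incident if they are closed in the same vertex. The equivalence $\equiv$ (for $\mathrm{char}(K)=2$) is the equivalence relation on the set of closed paths of $Q$ together with the symbol $0$ generated by: (1) $ab\equiv ba$ for paths $a,b$ such that $ab$ is a closed path; (2) $a_{\sigma(1)}\cdots a_{\sigma(t)}\equiv a_1\cdots a_t$ for incident closed paths $a_1,\dots,a_t$, $t\geq2$, $\sigma\in S_t$; (3) $a_1^2a_2\equiv0$ for incident closed paths $a_1,a_2$; (4) $a_1^2\equiv0$ for every closed path $a_1$. -}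

module Defs where

open import Algebra.Apartness using (HeytingField)
open import Data.Fin using (Fin; zero; suc)
open import Data.Fin.Permutation using (Permutation′; _⟨$⟩ʳ_)
open import Data.List using (List; []; _∷_; length; lookup; map)
open import Data.List.Membership.Propositional using (_∈_)
open import Data.Maybe using (Maybe; just; nothing)
open import Data.Nat using (ℕ; zero; suc; _≤_)
open import Data.Product using (∃; ∃!; _×_; _,_)
open import Function using (_∘_)
open import Function.Definitions using (Surjective)
open import Level using (Level; _⊔_)
open import Relation.Binary.Construct.Closure.Equivalence using (EqClosure)
open import Relation.Binary.Construct.Closure.Transitive using (TransClosure; [_]; _∷_; _++_)
open import Relation.Binary.PropositionalEquality using (_≡_)
open import Relation.Nullary using (¬_)

-- A Heyting field is the constructive form of a field: classically every field
-- is one, with x # y taken to be ¬ (x ≈ y).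

Infinite : ∀ {c ℓ₁ ℓ₂ : Level} → HeytingField c ℓ₁ ℓ₂ → Set (c ⊔ ℓ₁)
Infinite K = ∀ (k : ℕ) (f : Fin k → Carrier) → ¬ Surjective _≡_ _≈_ f
  where open HeytingField K

HasCharacteristic2 : ∀ {c ℓ₁ ℓ₂ : Level} → HeytingField c ℓ₁ ℓ₂ → Set ℓ₁
HasCharacteristic2 K = 1# + 1# ≈ 0#
  where open HeytingField K

-- Loops and multiple arrows are allowed.
record Quiver (n d : ℕ) : Set where
  field
    tail : Fin d → Fin n
    head : Fin d → Fin n

module _ {n d : ℕ} (Q : Quiver n d) where
  open Quiver Q

  Arrow : Fin n → Fin n → Set
  Arrow u v = ∃ λ (a : Fin d) → tail a ≡ u × head a ≡ v

  -- Paths have degree at least 1: there is no empty path.  Equality of vertices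
  -- is decidable, so the endpoint proofs inside a path are unique and a path is
  -- determined by its sequence of arrows.
  Path : Fin n → Fin n → Set
  Path = TransClosure Arrow

  -- The first component is the tail of the first arrow, i.e. the vertex in which
  -- the path is closed; incident closed paths are elements of the same Path v v.
  ClosedPath : Set
  ClosedPath = ∃ λ (v : Fin n) → Path v v

module _ {n d : ℕ} {Q : Quiver n d} where
  open Quiver Q

  arrows : ∀ {u v} → Path Q u v → List (Fin d)
  arrows [ (a , _) ]   = a ∷ []
  arrows ((a , _) ∷ p) = a ∷ arrows p

  deg : ∀ {u v} → Path Q u v → ℕ
  deg p = length (arrows p)

  V : ∀ {u v} → Path Q u v → List (Fin n)
  V {u} p = u ∷ map head (arrows p)

  Primitive : ∀ {v} → Path Q v v → Set
  Primitive p =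
    ∀ w → w ∈ V p → ∃! _≡_ λ (i : Fin (deg p)) → head (lookup (arrows p) i) ≡ w

  -- a₀ a₁ ⋯ aₜ
  product : ∀ {v t} → (Fin (suc t) → Path Q v v) → Path Q v v
  product {t = zero}  a = a zero
  product {t = suc _} a = a zero ++ product (a ∘ suc)

  -- Generators of the equivalence; `nothing` is the symbol 0.
  data Generator : Maybe (ClosedPath Q) → Maybe (ClosedPath Q) → Set where
    rotate : ∀ {u v} (a : Path Q u v) (b : Path Q v u) →
             Generator (just (u , a ++ b)) (just (v , b ++ a))
    permute : ∀ {v t} (σ : Permutation′ (suc (suc t)))
              (a : Fin (suc (suc t)) → Path Q v v) →
              Generator (just (v , product (a ∘ (σ ⟨$⟩ʳ_)))) (just (v , product a))
    square-factor : ∀ {v} (a₁ a₂ : Path Q v v) →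
                    Generator (just (v , (a₁ ++ a₁) ++ a₂)) nothing
    square : ∀ {v} (a₁ : Path Q v v) → Generator (just (v , a₁ ++ a₁)) nothing

  infix 4 _≋_ _≋0

  _≋_ : Maybe (ClosedPath Q) → Maybe (ClosedPath Q) → Set
  _≋_ = EqClosure Generator

  _≋0 : ClosedPath Q → Set
  h ≋0 = just h ≋ nothing

degree : ∀ {n d} {Q : Quiver n d} → ClosedPath Q → ℕ
degree (_ , p) = deg p

StronglyConnected : ∀ {n d} → Quiver n d → Set
StronglyConnected Q = ∃ λ v → ∃ λ (p : Path Q v v) → ∀ w → w ∈ V p

-- m(Q) = m
MaxPrimitiveDegree : ∀ {n d} → Quiver n d → ℕ → Set
MaxPrimitiveDegree Q m =
  (∃ λ v → ∃ λ (p : Path Q v v) → Primitive p × deg p ≡ m) ×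
  (∀ {v} (p : Path Q v v) → Primitive p → deg p ≤ m)

record 𝒬 (n d m : ℕ) : Set where
  field
    quiver             : Quiver n d
    stronglyConnected  : StronglyConnected quiver
    maxPrimitiveDegree : MaxPrimitiveDegree quiver m

{-# OPTIONS --safe #-}

-- Let h be closed in v₀ and nonzero, and call a vertex a root if it is v₀ or has indegree at
-- least 2.  An arrow that does not end in a root is the only arrow into its head, so every
-- occurrence of its head in h is preceded by it.
--
-- As a multiset of arrows, h is a sum of N primitive cycles.  Give an arrow that ends in a root
-- and occurs k times in h the weight 3 ∸ k, and every other arrow the weight 0.  Each of the
-- primitive cycles has weight at least 2.  Otherwise all its arrows into roots occur three
-- times in h, except for at most one, e, which occurs twice; then two disjoint copies of the
-- cycle can be grown inside h, starting from two occurrences of e and prepending one arrow b at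
-- a time.  If b does not end in a root this is automatic; if it does, permuting closed walks in
-- the head of b turns α A b B b C into bα A b C B, and the third occurrence of b allows this
-- for both copies.  In the end h contains the square of a closed path and vanishes.
--
-- Since k (3 ∸ k) ≤ 2, the weights along h sum to at most twice the number of arrows into
-- roots, so N is at most that number, which is at most 2 (d - n) + 1 as every indegree is
-- positive.
module Submission where

open import Defs
open import Algebra.Apartness using (HeytingField)
open import Data.Fin using (Fin; zero; suc; _≟_)
import Data.Fin.Permutation as Perm
import Data.Integer as ℤ
import Data.Integer.Properties as ℤ
import Data.Integer.Tactic.RingSolver as ℤ-solve
open import Data.List using (List; []; tabulate; _∷_; _++_; [_]; _∷ʳ_; allFin; concat; length;
  lookup; map; filter; initLast; _∷ʳ′_; _ʳ++_; reverse)
open import Data.List.Membership.Propositional using (_∈_; _∉_; find)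
open import Data.List.Membership.Propositional.Properties using (∈-∃++; ∈-++⁺ʳ; ∈-++⁻; ∈-map⁻;
  ∈-map⁺; ∈-filter⁻; ∈-filter⁺; ∈-length; ∈-lookup; ∈-concat⁺′; ∈-allFin)
open import Data.List.Properties using (++-assoc; ++-identityʳ; ++-monoid; concat-++;
  concat-map-[_]; ∷-injectiveʳ; filter-accept; filter-reject; filter-++; length-++; length-++-≤ˡ;
  map-tabulate; map-++; ʳ++-defn; reverse-involutive)
open import Data.List.Relation.Binary.Permutation.Propositional using (_↭_; ↭-refl; ↭-sym; ↭-trans;
  ↭-prep; ↭-swap; ↭-reflexive; ↭⇒↭ₛ)
open import Data.List.Relation.Binary.Permutation.Propositional.Properties using (shift; drop-∷;
  ∈-resp-↭; ↭-length; filter-↭; ++⁺; ++⁺ˡ; ++-comm; shifts; ↭-reverse; ¬x∷xs↭[]) renaming (map⁺ to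
  ↭-map⁺)
open import Data.List.Relation.Binary.Permutation.Setoid.Properties using (Unique-resp-↭)
open import Data.List.Relation.Unary.All as All using (All; []; _∷_)
open import Data.List.Relation.Unary.All.Properties using (¬Any⇒All¬) renaming (++⁺ to All-++⁺)
open import Data.List.Relation.Unary.AllPairs as AllPairs using (AllPairs; []; _∷_)
open import Data.List.Relation.Unary.Any as Any using (here; there; any?)
open import Data.List.Relation.Unary.Any.Properties using (lookup-index)
open import Data.List.Relation.Unary.Unique.Propositional using (Unique)
import Data.Nat as ℕ
open import Data.Nat using (ℕ)
open import Data.Nat.ListAction using (sum)
open import Data.Nat.ListAction.Properties using (sum-++; sum-↭)
import Data.Nat.Tactic.RingSolver as ℕ-solve
open import Data.Product using (∃; ∃₂; _×_; _,_; proj₁; proj₂)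
open import Data.Sum using (_⊎_; inj₁; inj₂; map₂)
open import Level using (Level)
open import Relation.Binary.Construct.Closure.ReflexiveTransitive using (ε; _◅_)
open import Relation.Binary.Construct.Closure.Symmetric using (fwd; bwd)
import Relation.Binary.Construct.Closure.Transitive as Path
open import Relation.Binary.PropositionalEquality using (_≡_; _≢_; refl; sym; trans; cong; cong₂;
  subst; subst₂; setoid; module ≡-Reasoning)
open import Relation.Nullary using (¬_; Dec; yes; no; contradiction)
open import Relation.Nullary.Decidable using (_⊎-dec_)
open import Tactic.MonoidSolver using (solve)

-- Multiplicities, sums and repetitions in lists.

module _ where
  open import Data.Nat using (ℕ; zero; suc; _+_; _*_; _∸_; _≤_; _≤?_; s≤s; s≤s⁻¹; z≤n)
  open import Data.Nat.Properties hiding (_≟_)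
  open import Algebra.Properties.CommutativeMonoid.Sum +-0-commutativeMonoid using (∑-distrib-+;
    sum-cong-≗) renaming (sum to ∑)

  count : ∀ {A : Set} {k} → (A → Fin k) → Fin k → List A → ℕ
  count g v xs = length (filter (λ x → g x ≟ v) xs)

  mult : ∀ {k} → Fin k → List (Fin k) → ℕ
  mult = count (λ x → x)

  ∈⇒↭ : ∀ {A : Set} {x : A} {xs} → x ∈ xs → ∃ λ ys → xs ↭ x ∷ ys
  ∈⇒↭ x∈xs with ys , zs , refl ← ∈-∃++ x∈xs = ys ++ zs , shift _ ys zs

  mult-↭ : ∀ {k} (x : Fin k) {xs ys} → xs ↭ ys → mult x xs ≡ mult x ys
  mult-↭ x p = ↭-length (filter-↭ (_≟ x) p)

  mult-self : ∀ {k} (x : Fin k) xs → mult x (x ∷ xs) ≡ suc (mult x xs)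
  mult-self x xs = cong length (filter-accept (_≟ x) {xs = xs} refl)

  mult-++ : ∀ {k} (x : Fin k) xs ys → mult x (xs ++ ys) ≡ mult x xs + mult x ys
  mult-++ x xs ys = trans (cong length (filter-++ (_≟ x) xs ys)) (length-++ (filter (_≟ x) xs))

  mult-∉ : ∀ {k} {x : Fin k} {xs} → x ∉ xs → mult x xs ≡ 0
  mult-∉ {xs = []}     _    = refl
  mult-∉ {x = x} {xs = y ∷ xs} x∉ =
    trans (cong length (filter-reject (_≟ x) {x = y} {xs = xs} (λ { refl → x∉ (here refl) }))) (mult-∉ {xs = xs} (λ x∈ → x∉ (there x∈)))

  mult-remove : ∀ {k r} {x : Fin k} {xs} → suc r ≤ mult x xs → ∃ λ ys → xs ↭ x ∷ ys × r ≤ mult x ys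
  mult-remove {x = x} {xs} r≤ with filter (_≟ x) xs in eq
  ... | y ∷ ys with y∈xs , refl ← ∈-filter⁻ (_≟ x) {xs = xs} (subst (y ∈_) (sym eq) (here refl))
               with zs , p ← ∈⇒↭ y∈xs
               = zs , p , s≤s⁻¹ (≤-trans r≤ (≤-reflexive
                   (trans (cong length (sym eq)) (trans (mult-↭ x p) (mult-self x zs)))))

  split-twice : ∀ {A : Set} {x : A} {xs ys} → xs ↭ x ∷ x ∷ ys →
                ∃ λ as → ∃₂ λ bs cs → xs ≡ as ++ x ∷ bs ++ x ∷ cs
  split-twice {x = x} p with as , cs , refl ← ∈-∃++ (∈-resp-↭ (↭-sym p) (here refl))
    with ∈-++⁻ as (∈-resp-↭ (↭-sym (drop-∷ (↭-trans (↭-sym (shift x as cs)) p))) (here refl))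
  ... | inj₁ x∈as with as₁ , as₂ , refl ← ∈-∃++ x∈as = as₁ , as₂ , cs , ++-assoc as₁ _ _
  ... | inj₂ x∈cs with cs₁ , cs₂ , refl ← ∈-∃++ x∈cs = as , cs₁ , cs₂ , refl

  -- As `t` differs from `[ x ]`, taking out a factor `[ x ]` leaves the block `t` intact and uses
  -- up one of the single arrows.
  singletons-remove : ∀ {A : Set} {x : A} {t us xs} → t ≢ [ x ] → [ x ] ∷ us ↭ t ∷ map [_] xs →
                      ∃ λ ys → xs ↭ x ∷ ys × us ↭ t ∷ map [_] ys
  singletons-remove {x = x} {t} t≢ p with ∈-resp-↭ p (here refl)
  ... | here eq = contradiction (sym eq) t≢
  ... | there [x]∈ with _ , x∈xs , refl ← ∈-map⁻ [_] [x]∈ with ys , q ← ∈⇒↭ x∈xs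
    = ys , q , drop-∷ (↭-trans p (↭-trans (↭-prep t (↭-map⁺ [_] q)) (↭-swap t [ x ] ↭-refl)))

  concat-++-∷ : ∀ {A : Set} (xss : List (List A)) ys zss → concat (xss ++ ys ∷ zss) ≡ concat xss ++ ys ++ concat zss
  concat-++-∷ xss ys zss = sym (concat-++ xss (ys ∷ zss))

  unique-ʳ++⁻ : ∀ {A : Set} (xs : List A) {ys} → Unique (xs ʳ++ ys) → Unique ys
  unique-ʳ++⁻ []       u = u
  unique-ʳ++⁻ (x ∷ xs) u with _ ∷ v ← unique-ʳ++⁻ xs u = v

  count-∷ : ∀ {A : Set} {k} (g : A → Fin k) v x xs → count g v (x ∷ xs) ≡ mult v [ g x ] + count g v xs
  count-∷ g v x xs with g x ≟ v
  ... | yes _ = refl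
  ... | no  _ = refl

  count-∈ : ∀ {A : Set} {k} (g : A → Fin k) {v x xs} → x ∈ xs → g x ≡ v → 1 ≤ count g v xs
  count-∈ g x∈ eq = ∈-length (∈-filter⁺ (λ x → g x ≟ _) x∈ eq)

  count-≱2 : ∀ {A : Set} {k} (g : A → Fin k) {v x y xs} → ¬ 2 ≤ count g v xs →
             x ∈ xs → g x ≡ v → y ∈ xs → g y ≡ v → x ≡ y
  count-≱2 g {v} {xs = xs} ≱2 x∈ ex y∈ ey =
    same (filter (λ z → g z ≟ v) xs) ≱2 (∈-filter⁺ (λ z → g z ≟ v) x∈ ex) (∈-filter⁺ (λ z → g z ≟ v) y∈ ey)
    where
    same : ∀ zs {x y} → ¬ 2 ≤ length zs → x ∈ zs → y ∈ zs → x ≡ y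
    same (_ ∷ [])    _  (here refl) (here refl) = refl
    same (_ ∷ _ ∷ _) ≱2 _           _           = contradiction (s≤s (s≤s z≤n)) ≱2

  ∑-const : ∀ k c → ∑ {k} (λ _ → c) ≡ k * c
  ∑-const zero    c = refl
  ∑-const (suc k) c = cong (c +_) (∑-const k c)

  ∑-mono-≤ : ∀ {k} {f g : Fin k → ℕ} → (∀ i → f i ≤ g i) → ∑ f ≤ ∑ g
  ∑-mono-≤ {zero}  f≤g = z≤n
  ∑-mono-≤ {suc k} f≤g = +-mono-≤ (f≤g zero) (∑-mono-≤ (λ i → f≤g (suc i)))

  -- `mult v [ x ]` is the Kronecker delta.
  ∑-select : ∀ {k} (w : Fin k → ℕ) x → ∑ (λ v → mult v [ x ] * w v) ≡ w x
  ∑-select {suc k} w zero    = trans (cong₂ _+_ (+-identityʳ (w zero)) (trans (∑-const k 0) (*-zeroʳ k))) (+-identityʳ (w zero))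
  ∑-select {suc k} w (suc x) = trans (sum-cong-≗ (λ v → cong (_* w (suc v)) (mult-suc v))) (∑-select (λ v → w (suc v)) x)
    where
    mult-suc : ∀ v → mult (suc v) [ suc x ] ≡ mult v [ x ]
    mult-suc v with x ≟ v
    ... | yes _ = refl
    ... | no  _ = refl

  -- Serves with the identity, to group the occurrences in a walk by arrow, and with `head`, to
  -- group the arrows of the quiver by vertex.
  sum-by-fibre : ∀ {A : Set} {k} (g : A → Fin k) (w : Fin k → ℕ) xs →
                 sum (map (λ x → w (g x)) xs) ≡ ∑ (λ v → count g v xs * w v)
  sum-by-fibre {k = k} g w []       = sym (trans (∑-const k 0) (*-zeroʳ k))
  sum-by-fibre g w (x ∷ xs) = begin
    w (g x) + sum (map (λ x → w (g x)) xs)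
      ≡⟨ cong₂ _+_ (∑-select w (g x)) (sym (sum-by-fibre g w xs)) ⟨
    ∑ (λ v → mult v [ g x ] * w v) + ∑ (λ v → count g v xs * w v)
      ≡⟨ ∑-distrib-+ (λ v → mult v [ g x ] * w v) (λ v → count g v xs * w v) ⟨
    ∑ (λ v → mult v [ g x ] * w v + count g v xs * w v)
      ≡⟨ sum-cong-≗ (λ v → trans (cong (_* w v) (count-∷ g v x xs)) (*-distribʳ-+ (w v) (mult v [ g x ]) _)) ⟨
    ∑ (λ v → count g v (x ∷ xs) * w v) ∎
    where open ≡-Reasoning

  ∈⇒≤sum : ∀ {A : Set} (f : A → ℕ) {x xs} → x ∈ xs → f x ≤ sum (map f xs)
  ∈⇒≤sum f (here refl)          = m≤m+n _ _
  ∈⇒≤sum f (there {x = y} x∈) = ≤-trans (∈⇒≤sum f x∈) (m≤n+m _ (f y))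

  sum-map-concat-≥ : ∀ {A : Set} (f : A → ℕ) {c} {xss} → All (λ xs → c ≤ sum (map f xs)) xss →
                     length xss * c ≤ sum (map f (concat xss))
  sum-map-concat-≥ f []                   = z≤n
  sum-map-concat-≥ f {xss = xs ∷ xss} (c≤ ∷ all) = ≤-trans (+-mono-≤ c≤ (sum-map-concat-≥ f all))
    (≤-reflexive (trans (sym (sum-++ (map f xs) _)) (cong sum (sym (map-++ f xs (concat xss))))))

  length-concat-≤ : ∀ {A : Set} {m} {xss : List (List A)} → All (λ xs → length xs ≤ m) xss →
                    length (concat xss) ≤ length xss * m
  length-concat-≤ []                        = z≤n
  length-concat-≤ {xss = xs ∷ xss} (≤m ∷ all) = ≤-trans (≤-reflexive (length-++ xs)) (+-mono-≤ ≤m (length-concat-≤ all))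

  -- Gives the uniqueness of the position that `Primitive` demands.
  pairs-lookup-injective : ∀ {A B : Set} {g : A → B} {xs} → AllPairs (λ x y → g x ≢ g y) xs →
                           ∀ i j → g (lookup xs i) ≡ g (lookup xs j) → i ≡ j
  pairs-lookup-injective (_  ∷ _)  zero    zero    _  = refl
  pairs-lookup-injective (≢s ∷ _)  zero    (suc j) eq = contradiction eq (All.lookup ≢s (∈-lookup j))
  pairs-lookup-injective (≢s ∷ _)  (suc i) zero    eq = contradiction (sym eq) (All.lookup ≢s (∈-lookup i))
  pairs-lookup-injective (_  ∷ ps) (suc i) (suc j) eq = cong suc (pairs-lookup-injective ps i j eq)

  -- The cuts come after `x` and after `y`: when `g` is `head` and the list is a walk, the piece
  -- `bs ∷ʳ y` is then a closed walk.
  repeated-value : ∀ {A : Set} {k} (g : A → Fin k) xs →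
                   AllPairs (λ x y → g x ≢ g y) xs ⊎
                   ∃₂ λ as x → ∃₂ λ bs y → ∃ λ cs → xs ≡ (as ∷ʳ x) ++ (bs ∷ʳ y) ++ cs × g x ≡ g y
  repeated-value g [] = inj₁ []
  repeated-value g (x ∷ xs) with any? (λ y → g x ≟ g y) xs
  ... | yes x∈ with y , y∈ , eq ← find x∈ with bs , cs , refl ← ∈-∃++ y∈
    = inj₂ ([] , x , bs , y , cs , cong (x ∷_) (sym (++-assoc bs [ y ] cs)) , eq)
  ... | no x∉ with repeated-value g xs
  ...   | inj₁ pairs = inj₁ (¬Any⇒All¬ xs x∉ ∷ pairs)
  ...   | inj₂ (as , y , bs , z , cs , refl , eq) = inj₂ (x ∷ as , y , bs , z , cs , refl , eq)

  ∑-allFin : ∀ {k} (f : Fin k → ℕ) → ∑ f ≡ sum (map f (allFin k))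
  ∑-allFin f = trans (∑-tabulate f) (cong sum (sym (map-tabulate (λ i → i) f)))
    where
    ∑-tabulate : ∀ {k} (f : Fin k → ℕ) → ∑ f ≡ sum (tabulate f)
    ∑-tabulate {zero}  f = refl
    ∑-tabulate {suc k} f = cong (_+_ (f zero)) (∑-tabulate (λ i → f (suc i)))

-- Walks as lists of arrows.

module _ {n d} {Q : Quiver n d} where
  open Quiver Q
  open import Data.Nat using (ℕ; zero; suc; _+_; _*_; _∸_; _≤_; _≤?_; s≤s; s≤s⁻¹; z≤n)
  open import Data.Nat.Properties hiding (_≟_)
  open import Algebra.Properties.CommutativeMonoid.Sum +-0-commutativeMonoid using (∑-distrib-+;
    sum-cong-≗) renaming (sum to ∑)
  open import Algebra.Properties.CommutativeSemigroup *-commutativeSemigroup using (x∙yz≈y∙xz)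

  -- Unlike a `Path`, a walk may be empty, and its arrows are an index, so that rearrangements are
  -- equations between lists.
  Walk : Fin n → List (Fin d) → Fin n → Set
  Walk u []      v = u ≡ v
  Walk u (a ∷ l) v = tail a ≡ u × Walk (head a) l v

  walk-++ : ∀ x {y u v w} → Walk u x v → Walk v y w → Walk u (x ++ y) w
  walk-++ []      refl    q = q
  walk-++ (a ∷ x) (e , p) q = e , walk-++ x p q

  walk-++⁻ : ∀ x {y u w} → Walk u (x ++ y) w → ∃ λ v → Walk u x v × Walk v y w
  walk-++⁻ []      p       = _ , refl , p
  walk-++⁻ (a ∷ x) (e , p) with v , q , r ← walk-++⁻ x p = v , (e , q) , r

  walk-rotate : ∀ x {y v} → Walk v (x ++ y) v → ∃ λ w → Walk w (y ++ x) w
  walk-rotate x {y} p with w , q , r ← walk-++⁻ x p = w , walk-++ y r q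

  walk-∷ʳ : ∀ x {a u v} → Walk u (x ∷ʳ a) v → head a ≡ v
  walk-∷ʳ x p with _ , _ , _ , e ← walk-++⁻ x p = e

  walk-cut : ∀ x {a y u v} → Walk u (x ∷ʳ a ++ y) v → Walk u (x ∷ʳ a) (head a) × Walk (head a) y v
  walk-cut x {a} p with w , q , r ← walk-++⁻ (x ∷ʳ a) p with refl ← walk-∷ʳ x q = q , r

  fromPath : ∀ {u v} (p : Path Q u v) → Walk u (arrows p) v
  fromPath Path.[ _ , e , f ]     = e , f
  fromPath ((_ , e , refl) Path.∷ p) = e , fromPath p

  toPath : ∀ a l {u v} → Walk u (a ∷ l) v → ∃ λ (p : Path Q u v) → arrows p ≡ a ∷ l
  toPath a []      (e , f) = Path.[ a , e , f ] , refl
  toPath a (b ∷ l) (e , p) with q , eq ← toPath b l p = (a , e , refl) Path.∷ q , cong (a ∷_) eq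

  arrows-++ : ∀ {u v w} (p : Path Q u v) (q : Path Q v w) →
              arrows (p Path.++ q) ≡ arrows p ++ arrows q
  arrows-++ Path.[ _ ]   q = refl
  arrows-++ ((a , _) Path.∷ p) q = cong (a ∷_) (arrows-++ p q)

  arrows-nonempty : ∀ {u v} (p : Path Q u v) → arrows p ≢ []
  arrows-nonempty Path.[ _ ]   ()
  arrows-nonempty (_ Path.∷ _) ()

  arrows-injective : ∀ {u v} (p q : Path Q u v) → arrows p ≡ arrows q → p ≡ q
  arrows-injective Path.[ a , refl , refl ] Path.[ .a , refl , refl ] refl = refl
  arrows-injective Path.[ _ ] (_ Path.∷ q) eq = contradiction (sym (∷-injectiveʳ eq)) (arrows-nonempty q)
  arrows-injective (_ Path.∷ p) Path.[ _ ] eq = contradiction (∷-injectiveʳ eq) (arrows-nonempty p)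
  arrows-injective ((a , refl , refl) Path.∷ p) ((b , e , f) Path.∷ q) eq
    with refl ← cong (λ { [] → a ; (x ∷ _) → x }) eq | refl ← e | refl ← f
    = cong (_ Path.∷_) (arrows-injective p q (∷-injectiveʳ eq))

  walk-source : ∀ {l u u′ v v′} → l ≢ [] → Walk u l v → Walk u′ l v′ → u ≡ u′
  walk-source {[]}    ne _       _       = contradiction refl ne
  walk-source {_ ∷ _} _  (e , _) (f , _) = trans (sym e) f

  -- The base vertex is the tail of the first arrow. Hence whether a closed path vanishes can be
  -- read off its list of arrows.
  closedPath-injective : ∀ (p q : ClosedPath Q) → arrows (proj₂ p) ≡ arrows (proj₂ q) → p ≡ q
  closedPath-injective (u , p) (v , q) eq
    with refl ← walk-source (arrows-nonempty q) (subst (λ l → Walk u l u) eq (fromPath p)) (fromPath q)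
    = cong (u ,_) (arrows-injective p q eq)

  -- The generators of the equivalence as rules for lists of arrows.

  -- Vacuously true of lists that are not closed walks.
  Null : List (Fin d) → Set
  Null l = (p : ClosedPath Q) → arrows (proj₂ p) ≡ l → p ≋0

  null : (p : ClosedPath Q) → p ≋0 → Null (arrows (proj₂ p))
  null p z q eq = subst _≋0 (closedPath-injective p q (sym eq)) z

  null-++-comm : ∀ {u v} (p : Path Q u v) (q : Path Q v u) →
                 Null (arrows q ++ arrows p) → Null (arrows p ++ arrows q)
  null-++-comm p q z = subst Null (arrows-++ p q)
    (null (_ , p Path.++ q) (fwd (rotate p q) ◅ z (_ , q Path.++ p) (arrows-++ q p)))

  -- Empty parts need their own cases because a `Path` has at least one arrow.
  null-rotate : ∀ x y → Null (y ++ x) → Null (x ++ y)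
  null-rotate []      y       = subst Null (++-identityʳ y)
  null-rotate (a ∷ x) []      = subst Null (sym (++-identityʳ (a ∷ x)))
  null-rotate (a ∷ x) (b ∷ y) z (v , r) eq
    with w , wx , wy ← walk-++⁻ (a ∷ x) (subst (λ l → Walk v l v) eq (fromPath r))
    with p , ep ← toPath a x wx | q , eq′ ← toPath b y wy
    = null-++-comm p q (subst Null (cong₂ _++_ (sym eq′) (sym ep)) z) (v , r)
        (trans eq (cong₂ _++_ (sym ep) (sym eq′)))

  null-++-swap : ∀ {w} (p q r : Path Q w w) →
                 Null (arrows q ++ arrows p ++ arrows r) → Null (arrows p ++ arrows q ++ arrows r)
  null-++-swap {w} p q r z = subst Null (arrows-++₃ p q)
    (null (_ , p Path.++ (q Path.++ r))
      (bwd (permute (Perm.transpose zero (suc zero)) blocks) ◅ z (_ , q Path.++ (p Path.++ r)) (arrows-++₃ q p)))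
    where
    arrows-++₃ : ∀ (s t : Path Q w w) → arrows (s Path.++ (t Path.++ r)) ≡ arrows s ++ arrows t ++ arrows r
    arrows-++₃ s t = trans (arrows-++ s _) (cong (arrows s ++_) (arrows-++ t r))
    blocks : Fin 3 → Path Q w w
    blocks zero             = p
    blocks (suc zero)       = q
    blocks (suc (suc zero)) = r

  -- `permute` with three factors. An empty `x` or `y` leaves nothing to swap, and an empty `z`
  -- turns the swap into a rotation.
  null-swap : ∀ x y z {w} → Walk w x w → Walk w y w → Walk w z w →
              Null (y ++ x ++ z) → Null (x ++ y ++ z)
  null-swap []      y       z       _  _  _  nil = nil
  null-swap (_ ∷ _) []      z       _  _  _  nil = nil
  null-swap x@(_ ∷ _) y@(_ ∷ _) [] _ _ _ nil =
    subst Null (sym (cong (x ++_) (++-identityʳ y)))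
      (null-rotate x y (subst Null (cong (y ++_) (++-identityʳ x)) nil))
  null-swap (a ∷ x) (b ∷ y) (c ∷ z) {w} wx wy wz nil
    with p , ep ← toPath a x wx | q , eq ← toPath b y wy | r , er ← toPath c z wz
    = subst Null (cong₂ _++_ ep (cong₂ _++_ eq er)) (null-++-swap p q r
        (subst Null (sym (cong₂ _++_ eq (cong₂ _++_ ep er))) nil))

  null-square : ∀ x z {w} → x ≢ [] → Walk w x w → Walk w z w → Null (x ++ x ++ z)
  null-square []      z       ne _ _ = contradiction refl ne
  null-square (a ∷ x) [] {w} _ wx wz with p , ep ← toPath a x wx =
    subst Null (trans (arrows-++ p p) (cong₂ _++_ ep (trans ep (sym (++-identityʳ (a ∷ x))))))
      (null (w , p Path.++ p) (fwd (square p) ◅ ε))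
  null-square (a ∷ x) (c ∷ z) {w} _ wx wz with p , ep ← toPath a x wx | q , eq ← toPath c z wz =
    subst Null (trans (arrows-++ (p Path.++ p) q)
                 (trans (cong (_++ arrows q) (arrows-++ p p))
                   (trans (++-assoc (arrows p) _ _) (cong₂ _++_ ep (cong₂ _++_ ep eq)))))
      (null (w , (p Path.++ p) Path.++ q) (fwd (square-factor p q) ◅ ε))

  -- Growing two copies of a cycle inside a closed walk.

  walk-ʳ++⁻ : ∀ xs {ys u v} → Walk u (xs ʳ++ ys) v → ∃ λ w → Walk w ys v
  walk-ʳ++⁻ []       p = _ , p
  walk-ʳ++⁻ (x ∷ xs) p with w , _ , q ← walk-ʳ++⁻ xs p = _ , q

  -- A closed walk is cut into a list of factors, so that a factor which is to be
  -- kept intact is a single element of the list.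
  Pulled : Fin d → List (Fin d) → List (List (Fin d)) → Set
  Pulled b α U = ∃₂ λ U′ w → U ↭ [ b ] ∷ U′ × Walk w (concat ((b ∷ α) ∷ U′)) w ×
                 (Null (concat ((b ∷ α) ∷ U′)) → Null (concat (α ∷ U)))

  -- The closed subwalks α A b and B b of α A b B b C change places.
  pull-repeated : ∀ {b α U V} → Walk (head b) (concat (α ∷ U)) (head b) →
                  U ↭ [ b ] ∷ [ b ] ∷ V → Pulled b α U
  pull-repeated {b} {α} {U} p perm with A , B , C , refl ← split-twice perm
    -- The new walk b α A b C B rotates to B b α A b C, which is `P₂ ++ P₁ ++ c`; swapping the first
    -- two closed walks gives back α A b B b C.
    = A ++ [ b ] ∷ C ++ B , tail b ,
      ↭-trans (shift [ b ] A _)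
        (↭-prep [ b ] (++⁺ˡ A (↭-trans (++-comm B _) (↭-prep [ b ] ↭-refl)))) ,
      subst (λ l → Walk (tail b) l (tail b)) (sym new) w′ ,
      λ z → subst Null (sym old) (null-swap P₁ P₂ c (proj₁ cut₁) (proj₁ cut₂) (proj₂ cut₂)
              (subst Null (eq₂ (concat B) [ b ] α (concat A) c)
                (null-rotate (concat B) _ (subst Null (trans new (eq₃ (concat B) [ b ] α (concat A) c)) z))))
    where
    P₁ P₂ c : List (Fin d)
    P₁ = (α ++ concat A) ++ [ b ]
    P₂ = concat B ++ [ b ]
    c  = concat C
    eq₁ : ∀ (α a β e c : List (Fin d)) → α ++ a ++ β ++ e ++ β ++ c ≡ ((α ++ a) ++ β) ++ (e ++ β) ++ c
    eq₁ α a β e c = solve (++-monoid (Fin d))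
    eq₂ : ∀ (e β α a c : List (Fin d)) → e ++ β ++ α ++ a ++ β ++ c ≡ (e ++ β) ++ ((α ++ a) ++ β) ++ c
    eq₂ e β α a c = solve (++-monoid (Fin d))
    eq₃ : ∀ (e β α a c : List (Fin d)) → β ++ α ++ a ++ β ++ c ++ e ≡ (β ++ α ++ a ++ β ++ c) ++ e
    eq₃ e β α a c = solve (++-monoid (Fin d))
    old : concat (α ∷ A ++ [ b ] ∷ B ++ [ b ] ∷ C) ≡ P₁ ++ P₂ ++ c
    old = trans (cong (α ++_) (trans (concat-++-∷ A [ b ] _) (cong (λ l → concat A ++ b ∷ l) (concat-++-∷ B [ b ] C))))
            (eq₁ α (concat A) [ b ] (concat B) c)
    new : concat ((b ∷ α) ∷ A ++ [ b ] ∷ C ++ B) ≡ b ∷ α ++ concat A ++ b ∷ c ++ concat B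
    new = cong (λ l → b ∷ α ++ l) (trans (concat-++-∷ A [ b ] _) (cong (λ l → concat A ++ b ∷ l) (sym (concat-++ C B))))
    cut₁ : Walk (head b) P₁ (head b) × Walk (head b) (P₂ ++ c) (head b)
    cut₁ = walk-cut (α ++ concat A) (subst (λ l → Walk (head b) l (head b)) old p)
    cut₂ : Walk (head b) P₂ (head b) × Walk (head b) c (head b)
    cut₂ = walk-cut (concat B) (proj₂ cut₁)
    w′ : Walk (tail b) (b ∷ α ++ concat A ++ b ∷ c ++ concat B) (tail b)
    w′ with v , q , e , _ ← walk-++⁻ (concat B) (proj₁ cut₂) = refl ,
      subst (λ l → Walk (head b) l (tail b)) (eq₄ α (concat A) [ b ] c (concat B))
        (walk-++ P₁ (proj₁ cut₁) (walk-++ c (proj₂ cut₂) (subst (Walk (head b) (concat B)) (sym e) q)))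
      where
      eq₄ : ∀ (α a β c e : List (Fin d)) → ((α ++ a) ++ β) ++ c ++ e ≡ α ++ a ++ β ++ c ++ e
      eq₄ α a β c e = solve (++-monoid (Fin d))

  Forced : Fin d → Set
  Forced b = ∀ a → head a ≡ head b → a ≡ b

  -- Stated for a suffix, so that the last arrow is known to lie in `a ∷ y`.
  walk-last : ∀ x {a y u v} → Walk u (x ++ a ∷ y) v → ∃ λ b → b ∈ a ∷ y × head b ≡ v
  walk-last x {a} {y} p with _ , _ , q ← walk-++⁻ x p = last a y q
    where
    last : ∀ a y {u v} → Walk u (a ∷ y) v → ∃ λ b → b ∈ a ∷ y × head b ≡ v
    last a []      (_ , e) = a , here refl , e
    last a (b ∷ y) (_ , p) with c , c∈ , e ← last b y p = c , there c∈ , e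

  -- The walk ends in `head b`, so its last arrow is `b`. The last factor is not the block `t`,
  -- whose last arrow lies in `a ∷ α` and so differs from `b`; hence it is `[ b ]`, and a rotation
  -- moves it to the front.
  pull-forced : ∀ {b a α U t R} → Forced b → b ∉ a ∷ α → t ≡ a ∷ α ⊎ t ≡ b ∷ a ∷ α →
                Walk (head b) (concat ((a ∷ α) ∷ U)) (head b) → U ↭ t ∷ map [_] R → Pulled b (a ∷ α) U
  pull-forced {b} {a} {α} {U} forced b∉ t≡ p perm with initLast U
  ... | [] = contradiction (↭-sym perm) ¬x∷xs↭[]
  ... | U′ ∷ʳ′ s with s≡ s t≡ (∈-resp-↭ perm (∈-++⁺ʳ U′ (here refl)))
                        (subst (λ l → Walk (head b) l (head b)) eq p)
    where
    eq : concat ((a ∷ α) ∷ U′ ∷ʳ s) ≡ ((a ∷ α) ++ concat U′) ++ s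
    eq = trans (cong ((a ∷ α) ++_) (trans (concat-++-∷ U′ s []) (cong (concat U′ ++_) (++-identityʳ s))))
           (sym (++-assoc (a ∷ α) _ _))
    no-end : ∀ x {u} → ¬ Walk u (x ++ a ∷ α) (head b)
    no-end x q with c , c∈ , e ← walk-last x q = b∉ (subst (_∈ a ∷ α) (forced c e) c∈)
    s≡ : ∀ s {t x R u} → t ≡ a ∷ α ⊎ t ≡ b ∷ a ∷ α → s ∈ t ∷ map [_] R → Walk u (x ++ s) (head b) → s ≡ [ b ]
    s≡ s {x = x} (inj₁ refl) (here refl) q = contradiction q (no-end x)
    s≡ s {x = x} (inj₂ refl) (here refl) q =
      contradiction (subst (λ l → Walk _ l (head b)) (sym (++-assoc x [ b ] (a ∷ α))) q) (no-end (x ∷ʳ b))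
    s≡ s {x = x} _ (there s∈) q with r , _ , refl ← ∈-map⁻ [_] s∈ = cong [_] (forced r (walk-∷ʳ x q))
  ... | refl = U′ , proj₁ rotated , ↭-trans (++-comm U′ [ s ]) ↭-refl , proj₂ rotated ,
               λ z → subst Null (sym eq) (null-rotate ((a ∷ α) ++ concat U′) [ b ] z)
    where
    eq : concat ((a ∷ α) ∷ U′ ∷ʳ [ b ]) ≡ ((a ∷ α) ++ concat U′) ++ [ b ]
    eq = trans (cong ((a ∷ α) ++_) (concat-++-∷ U′ [ b ] [])) (sym (++-assoc (a ∷ α) _ _))
    rotated : ∃ λ w → Walk w (b ∷ (a ∷ α) ++ concat U′) w
    rotated = walk-rotate ((a ∷ α) ++ concat U′) (subst (λ l → Walk (head b) l (head b)) eq p)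

  -- `t` is the other copy: still `a ∷ α` when the first copy is extended, already `b ∷ a ∷ α` when
  -- the second is. Of the two occurrences of `b` in `R`, one is absorbed and one makes the swap
  -- possible.
  pull : ∀ {b a α U t R} → b ∉ a ∷ α → t ≡ a ∷ α ⊎ t ≡ b ∷ a ∷ α → Forced b ⊎ 2 ≤ mult b R →
         Walk (head b) (concat ((a ∷ α) ∷ U)) (head b) → U ↭ t ∷ map [_] R → Pulled b (a ∷ α) U
  pull b∉ t≡ (inj₁ forced) p perm = pull-forced forced b∉ t≡ p perm
  pull {b} {t = t} {R = R} b∉ t≡ (inj₂ 2≤) p perm
    with R₁ , p₁ , 1≤ ← mult-remove {xs = R} 2≤ with R₂ , p₂ , _ ← mult-remove {xs = R₁} 1≤ =
    pull-repeated p (↭-trans perm (↭-trans (↭-prep t (↭-map⁺ [_] (↭-trans p₁ (↭-prep b p₂)))) (shift′ [ b ])))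
    where
    shift′ : ∀ s {V} → t ∷ s ∷ s ∷ V ↭ s ∷ s ∷ t ∷ V
    shift′ s = ↭-trans (↭-swap t s ↭-refl) (↭-prep s (↭-swap t s ↭-refl))

  walk-target : ∀ l {u v w} → Walk u l v → Walk u l w → v ≡ w
  walk-target []      refl    refl    = refl
  walk-target (_ ∷ l) (_ , p) (_ , q) = walk-target l p q

  concat-split : ∀ (x : List (Fin d)) X y Y → concat (x ∷ X ++ y ∷ Y) ≡ (x ++ concat X) ++ (y ++ concat Y)
  concat-split x X y Y = trans (cong (x ++_) (concat-++-∷ X y Y)) (sym (++-assoc x _ _))

  -- The cycle is E ʳ++ α with α the part already built.  The closed walk consists of two copies
  -- of α and the single arrows R.
  null-collapse : ∀ l E {a α U R u w} → Unique (E ʳ++ a ∷ α) → Walk u (E ʳ++ a ∷ α) u →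
                  (∀ b → b ∈ E → Forced b ⊎ 3 ≤ mult b l) →
                  Walk w (concat ((a ∷ α) ∷ U)) w → U ↭ (a ∷ α) ∷ map [_] R →
                  (a ∷ α) ++ (a ∷ α) ++ R ↭ l → Null (concat ((a ∷ α) ∷ U))
  null-collapse l [] {a} {α} {U} _ wα _ p perm _
    with A , B , refl ← ∈-∃++ (∈-resp-↭ (↭-sym perm) (here refl))
    -- A nonempty list of arrows determines its end points, so both copies, and with them `A` and
    -- `B`, are closed in the same vertex.
    with v , wα′ , q ← walk-++⁻ (a ∷ α) p
    with refl ← walk-source (λ ()) wα wα′
    with refl ← walk-target (a ∷ α) wα wα′
    with v , wA , r ← walk-++⁻ (concat A) (subst (λ l → Walk v l v) (concat-++-∷ A (a ∷ α) B) q)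
    with refl ← walk-source (λ ()) wα (proj₁ (proj₂ (walk-++⁻ (a ∷ α) r)))
    with x , wα″ , wB ← walk-++⁻ (a ∷ α) r
    with refl ← walk-target (a ∷ α) wα wα″
    -- With `E` exhausted, `a ∷ α` is the whole cycle. The walk α A α B becomes A α α B by a swap
    -- and α α B A by a rotation, and this has a square factor.
    = subst Null (cong ((a ∷ α) ++_) (sym (concat-++-∷ A (a ∷ α) B)))
        (null-swap (a ∷ α) (concat A) ((a ∷ α) ++ concat B) wα wA r
          (null-rotate (concat A) ((a ∷ α) ++ (a ∷ α) ++ concat B)
            (subst Null (assoc (a ∷ α) (concat B) (concat A))
              (null-square (a ∷ α) (concat B ++ concat A) (λ ()) wα (walk-++ (concat B) wB wA)))))
    where
    assoc : ∀ (x y z : List (Fin d)) → x ++ x ++ y ++ z ≡ (x ++ x ++ y) ++ z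
    assoc x y z = solve (++-monoid (Fin d))
  null-collapse l (b ∷ E) {a} {α} {U} {R} {w = w} uniq wC cond p@(t≡ , _) perm total
    with _ , _ , t≡′ , _ ← walk-ʳ++⁻ E wC
    with b≢ ∷ _ ← unique-ʳ++⁻ E uniq
    -- In the cycle `b` precedes `a`, so `tail a`, where the closed walk starts, is `head b`.
    = extend (trans (sym t≡) t≡′) (λ b∈ → All.lookup b≢ b∈ refl) (cond b (here refl))
    where
    αs : List (Fin d)
    αs = a ∷ α
    total′ : ∀ {R₂} → R ↭ b ∷ b ∷ R₂ → (b ∷ αs) ++ (b ∷ αs) ++ R₂ ↭ l
    total′ {R₂} r = ↭-trans (↭-sym (↭-trans (++⁺ˡ αs (↭-trans (++⁺ˡ αs r) (shift b αs (b ∷ R₂))))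
                      (↭-trans (shift b αs (αs ++ b ∷ R₂)) (↭-prep b (++⁺ˡ αs (shift b αs R₂)))))) total
    -- Neither copy contains `b`, so all its occurrences in `l` are still among the single arrows.
    ≤mult : b ∉ αs → 3 ≤ mult b l → 3 ≤ mult b R
    ≤mult b∉ 3≤ = ≤-trans 3≤ (≤-reflexive (begin
      mult b l                       ≡⟨ mult-↭ b total ⟨
      mult b (αs ++ αs ++ R)         ≡⟨ mult-++ b αs (αs ++ R) ⟩
      mult b αs + mult b (αs ++ R)   ≡⟨ cong₂ _+_ (mult-∉ b∉) (mult-++ b αs R) ⟩
      mult b αs + mult b R           ≡⟨ cong (_+ mult b R) (mult-∉ b∉) ⟩
      mult b R                       ∎))
      where open ≡-Reasoning
    ≤mult′ : ∀ {R₁} → R ↭ b ∷ R₁ → 3 ≤ mult b R → 2 ≤ mult b R₁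
    ≤mult′ {R₁} r 3≤ = s≤s⁻¹ (≤-trans 3≤ (≤-reflexive (trans (mult-↭ b r) (mult-self b R₁))))
    rotated : ∀ A B {V} → A ++ αs ∷ B ↭ αs ∷ V → B ++ (b ∷ αs) ∷ A ↭ (b ∷ αs) ∷ V
    rotated A B q = ↭-trans (shift (b ∷ αs) B A)
      (↭-prep (b ∷ αs) (↭-trans (++-comm B A) (drop-∷ (↭-trans (↭-sym (shift αs A B)) q))))
    extend : w ≡ head b → b ∉ αs → Forced b ⊎ 3 ≤ mult b l → Null (concat (αs ∷ U))
    extend refl b∉ cond-b
      with U₁ , w₁ , q₁ , p₁ , null₁ ← pull b∉ (inj₁ refl) (map₂ (λ 3≤ → <⇒≤ (≤mult b∉ 3≤)) cond-b) p perm
      with R₁ , r₁ , perm₁ ← singletons-remove (λ { refl → b∉ (here refl) }) (↭-trans (↭-sym q₁) perm)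
      with A , B , refl ← ∈-∃++ (∈-resp-↭ (↭-sym perm₁) (here refl))
      -- The second copy is rotated to the front to be extended in turn. Unless `b` is forced, at
      -- least two of its occurrences remain after the first copy has taken one.
      with w₂ , p₂ ← walk-rotate ((b ∷ αs) ++ concat A) (subst (λ l → Walk w₁ l w₁) (concat-split (b ∷ αs) A αs B) p₁)
      with refl ← trans (sym (proj₁ p₂)) (proj₁ p)
      with U₃ , _ , q₃ , p₃ , null₃ ← pull {U = B ++ (b ∷ αs) ∷ A} b∉ (inj₂ refl) (map₂ (λ 3≤ → ≤mult′ r₁ (≤mult b∉ 3≤)) cond-b)
             (subst (λ l → Walk (head b) l (head b)) (sym (concat-split αs B (b ∷ αs) A)) p₂)
             (rotated A B perm₁)
      with R₂ , r₂ , perm₃ ← singletons-remove (λ ()) (↭-trans (↭-sym q₃) (rotated A B perm₁))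
      = null₁ (subst Null (sym (concat-split (b ∷ αs) A αs B))
          (null-rotate ((b ∷ αs) ++ concat A) (αs ++ concat B)
            (subst Null (concat-split αs B (b ∷ αs) A)
              (null₃ (null-collapse l E uniq wC (λ c c∈ → cond c (there c∈)) p₃ perm₃ (total′ (↭-trans r₁ (↭-prep b r₂))))))))

  -- Primitive cycles: decomposition and doubling.

  Simple : List (Fin d) → Set
  Simple = AllPairs (λ a b → head a ≢ head b)

  Cycle : List (Fin d) → Set
  Cycle l = Simple l × l ≢ [] × ∃ λ v → Walk v l v

  simple⇒unique : ∀ {l} → Simple l → Unique l
  simple⇒unique = AllPairs.map (λ ≢h eq → ≢h (cong head eq))

  simple⇒primitive : ∀ {v} (p : Path Q v v) → Simple (arrows p) → Primitive p
  simple⇒primitive {v} p simple w w∈ with head-onto w∈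
    where
    head-onto : ∀ {w} → w ∈ V p → w ∈ map head (arrows p)
    head-onto (there w∈) = w∈
    -- The base vertex is also the head of the last arrow.
    head-onto (here refl) with arrows p | arrows-nonempty p | fromPath p
    ... | []    | ne | _ = contradiction refl ne
    ... | a ∷ l | _  | q with b , b∈ , refl ← walk-last [] q = ∈-map⁺ head b∈
  ... | w∈′ with a , a∈ , refl ← ∈-map⁻ head w∈′
    = Any.index a∈ , cong head (sym (lookup-index a∈)) ,
      λ {j} eq → pairs-lookup-injective simple _ j (trans (cong head (sym (lookup-index a∈))) (sym eq))

  -- Induction on the bound `k`: if a and b have the same head, the closed walk x a y b z splits
  -- into the shorter closed walks y b and x a z.
  cycle-decomposition : ∀ k l {v} → length l ≤ k → l ≢ [] → Walk v l v →
                        ∃ λ Cs → All Cycle Cs × concat Cs ↭ l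
  cycle-decomposition zero    []      _  ne _ = contradiction refl ne
  cycle-decomposition (suc k) l {v} l≤ ne p with repeated-value head l
  ... | inj₁ simple = [ l ] , (simple , ne , v , p) ∷ [] , ↭-reflexive (++-identityʳ l)
  ... | inj₂ (x , a , y , b , z , refl , eq)
    = join (cycle-decomposition k (y ∷ʳ b) inner≤ (λ eq → nonempty y (sym eq)) inner)
           (cycle-decomposition k ((x ∷ʳ a) ++ z) outer≤ (outer-nonempty x) outer)
    where
    cut : Walk v (x ∷ʳ a) (head a) × Walk (head a) ((y ∷ʳ b) ++ z) v
    cut = walk-cut x p
    inner : Walk (head b) (y ∷ʳ b) (head b)
    inner = subst (λ u → Walk u (y ∷ʳ b) (head b)) eq (proj₁ (walk-cut y (proj₂ cut)))
    outer : Walk v ((x ∷ʳ a) ++ z) v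
    outer = walk-++ (x ∷ʳ a) (proj₁ cut) (subst (λ u → Walk u z v) (sym eq) (proj₂ (walk-cut y (proj₂ cut))))
    join : (∃ λ Cs → All Cycle Cs × concat Cs ↭ y ∷ʳ b) → (∃ λ Cs → All Cycle Cs × concat Cs ↭ (x ∷ʳ a) ++ z) →
           ∃ λ Cs → All Cycle Cs × concat Cs ↭ (x ∷ʳ a) ++ (y ∷ʳ b) ++ z
    join (Cs , cycles₁ , perm₁) (Ds , cycles₂ , perm₂) = Cs ++ Ds , All-++⁺ cycles₁ cycles₂ ,
      ↭-trans (↭-reflexive (sym (concat-++ Cs Ds)))
        (↭-trans (++⁺ perm₁ perm₂) (shifts (y ∷ʳ b) (x ∷ʳ a)))
    nonempty : ∀ (y : List (Fin d)) {b} → [] ≢ y ∷ʳ b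
    nonempty []      ()
    nonempty (_ ∷ _) ()
    outer-nonempty : ∀ (x : List (Fin d)) → (x ∷ʳ a) ++ z ≢ []
    outer-nonempty []      ()
    outer-nonempty (_ ∷ _) ()
    length-∷ʳ-> : ∀ (y : List (Fin d)) b w → suc (length w) ≤ length ((y ∷ʳ b) ++ w)
    length-∷ʳ-> []      b w = ≤-refl
    length-∷ʳ-> (_ ∷ y) b w = m≤n⇒m≤1+n (length-∷ʳ-> y b w)
    outer≤ : length ((x ∷ʳ a) ++ z) ≤ k
    outer≤ = s≤s⁻¹ (≤-trans (length-∷ʳ-> y b _) (≤-trans (≤-reflexive (↭-length (shifts (y ∷ʳ b) (x ∷ʳ a)))) l≤))
    inner≤ : length (y ∷ʳ b) ≤ k
    inner≤ = s≤s⁻¹ (≤-trans (s≤s (length-++-≤ˡ (y ∷ʳ b))) (≤-trans (length-∷ʳ-> x a ((y ∷ʳ b) ++ z)) l≤))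

  -- The start of the growth: `l` is rotated to begin with one `e`, another `e` is the second copy,
  -- and all else is single arrows. The cycle is rotated to end in `e`; the arrows of `C₂ ++ C₁` are
  -- then prepended from last to first, hence the `reverse`.
  null-doubled : ∀ {l} C₁ e C₂ {u v} → Walk v l v → Walk u (C₁ ++ e ∷ C₂) u → Unique (C₁ ++ e ∷ C₂) →
                 2 ≤ mult e l → (∀ b → b ∈ C₁ ++ C₂ → Forced b ⊎ 3 ≤ mult b l) → Null l
  null-doubled {l} C₁ e C₂ {v = v} p wC uniq 2≤ cond
    with l₁ , q₁ , 1≤ ← mult-remove {xs = l} 2≤
    with l₂ , q₂ , _  ← mult-remove {xs = l₁} 1≤
    with A , B , refl ← ∈-∃++ (∈-resp-↭ (↭-sym q₁) (here refl))
    with w , p′ ← walk-rotate A p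
    with w′ , wC′ ← walk-rotate (C₁ ∷ʳ e) (subst (λ l → Walk _ l _) (sym (++-assoc C₁ [ e ] C₂)) wC)
    = null-rotate A (e ∷ B) (subst Null (cong (e ∷_) (concat-map-[ B ++ A ]))
        (null-collapse (A ++ e ∷ B) (reverse (C₂ ++ C₁))
          (subst Unique (sym unreverse) (Unique-resp-↭ (setoid (Fin d)) (↭⇒↭ₛ
            (↭-trans (shift e C₁ C₂) (↭-trans (↭-prep e (++-comm C₁ C₂)) (++-comm [ e ] (C₂ ++ C₁))))) uniq))
          (subst (λ l → Walk w′ l w′) (sym unreverse) (subst (λ l → Walk w′ l w′) (sym (++-assoc C₂ C₁ [ e ])) wC′))
          (λ b b∈ → cond b (∈-resp-↭ (++-comm C₂ C₁) (∈-resp-↭ (↭-reverse (C₂ ++ C₁)) b∈)))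
          (subst (λ l → Walk w l w) (cong (e ∷_) (sym (concat-map-[ B ++ A ]))) p′)
          (↭-map⁺ [_] (↭-trans (++-comm B A) (drop-∷ (↭-trans (↭-sym (shift e A B)) (↭-trans q₁ (↭-prep e q₂))))))
          (↭-sym (↭-trans q₁ (↭-prep e q₂)))))
    where
    unreverse : reverse (C₂ ++ C₁) ʳ++ [ e ] ≡ (C₂ ++ C₁) ++ [ e ]
    unreverse = trans (ʳ++-defn (reverse (C₂ ++ C₁))) (cong (_++ [ e ]) (reverse-involutive (C₂ ++ C₁)))

  -- Indegrees, roots and weights.

  indeg : Fin n → ℕ
  indeg v = count head v (allFin d)

  stronglyConnected⇒indeg≥1 : StronglyConnected Q → ∀ v → 1 ≤ indeg v
  stronglyConnected⇒indeg≥1 (u , p , visits) v with visits v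
  ... | there v∈ with a , _ , refl ← ∈-map⁻ head v∈ = count-∈ head (∈-allFin a) refl
  ... | here refl with arrows p | arrows-nonempty p | fromPath p
  ...   | []    | ne | _ = contradiction refl ne
  ...   | a ∷ l | _  | q with b , _ , eq ← walk-last [] q = count-∈ head (∈-allFin b) eq

  module _ (v₀ : Fin n) (l : List (Fin d)) where

    Root : Fin n → Set
    Root v = v ≡ v₀ ⊎ 2 ≤ indeg v

    root? : ∀ v → Dec (Root v)
    root? v = (v ≟ v₀) ⊎-dec (2 ≤? indeg v)

    ρ : Fin n → ℕ
    ρ v with root? v
    ... | yes _ = 1
    ... | no  _ = 0

    -- Weight 0 means that the arrow can be prepended to both copies: it is forced or occurs at
    -- least three times. For an arrow into a root, weight at most 1 means that it occurs at least
    -- twice and can start both copies.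
    weight : Fin d → ℕ
    weight a = ρ (head a) * (3 ∸ mult a l)

    weight-root : ∀ {a} → Root (head a) → weight a ≡ 3 ∸ mult a l
    weight-root {a} root with root? (head a)
    ... | yes _ = +-identityʳ _
    ... | no ¬root = contradiction root ¬root

    weight-≥1 : ∀ {a} → 1 ≤ weight a → Root (head a)
    weight-≥1 {a} 1≤ with root? (head a)
    ... | yes root = root
    ... | no _ = contradiction 1≤ λ ()

    ¬root⇒forced : ∀ {b} → ¬ Root (head b) → Forced b
    ¬root⇒forced {b} ¬root a eq = count-≱2 head (λ 2≤ → ¬root (inj₂ 2≤)) (∈-allFin a) eq (∈-allFin b) refl

    weight-0 : ∀ b → weight b ≡ 0 → Forced b ⊎ 3 ≤ mult b l
    weight-0 b eq with root? (head b)
    ... | no ¬root = inj₁ (¬root⇒forced ¬root)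
    ... | yes _    = inj₂ (m∸n≡0⇒m≤n (trans (sym (+-identityʳ _)) eq))

    -- Once the cycle is rotated to begin with `a`, its last arrow ends in `tail a`.
    tail-is-head : ∀ {C u a} → Walk u C u → a ∈ C → ∃ λ c → c ∈ C × head c ≡ tail a
    tail-is-head p a∈ with X , Y , refl ← ∈-∃++ a∈
      with w , q@(e , _) ← walk-rotate X p with c , c∈ , eq ← walk-last [] q
      = c , ∈-resp-↭ (++-comm (_ ∷ Y) X) c∈ , trans eq (sym e)

    -- Otherwise every arrow of C is the only one ending in its head, so that
    -- following l backwards from an arrow of C never leaves C.
    cycle-has-root : ∀ {C u} → Walk v₀ l v₀ → Walk u C u → C ≢ [] → (∀ {a} → a ∈ C → a ∈ l) →
                     ∃ λ e → e ∈ C × Root (head e)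
    cycle-has-root {[]}    _ _  ne _ = contradiction refl ne
    cycle-has-root {a ∷ C} {u} p wC _ ⊆l with any? (λ e → root? (head e)) (a ∷ C)
    ... | yes any = find any
    ... | no ¬any = let c , c∈ , eq = enters l p (⊆l (here refl)) (here refl) in c , c∈ , inj₁ eq
      where
      enters : ∀ k {v w b} → Walk v k w → b ∈ k → b ∈ a ∷ C → ∃ λ c → c ∈ a ∷ C × head c ≡ v
      enters (b ∷ k) (e , q) (here refl) b∈ with c , c∈ , eq ← tail-is-head wC b∈ = c , c∈ , trans eq e
      enters (x ∷ k) (e , q) (there b∈k) b∈ with c , c∈ , eq ← enters k q b∈k b∈
        -- `c` is the only arrow into its head, and `x` ends there too, so `x` lies on the cycle.
        with refl ← ¬root⇒forced (λ root → ¬any (Any.map (λ { refl → root }) c∈)) x (sym eq)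
        with c′ , c′∈ , eq′ ← tail-is-head wC c∈ = c′ , c′∈ , trans eq′ e

    cycle-weight : ∀ {C} → Walk v₀ l v₀ → ¬ Null l → Cycle C → (∀ {a} → a ∈ C → a ∈ l) →
                   2 ≤ sum (map weight C)
    cycle-weight {C} p ¬null (simple , ne , u , wC) ⊆l with 2 ≤? sum (map weight C)
    ... | yes 2≤ = 2≤
    ... | no 2≰ = contradiction (light (any? (λ a → 1 ≤? weight a) C)) ¬null
      where
      doubled : ∀ {e} → e ∈ C → Root (head e) →
                (∀ {C₁ C₂} → C ≡ C₁ ++ e ∷ C₂ → weight e ≤ 1 × (∀ b → b ∈ C₁ ++ C₂ → weight b ≡ 0)) → Null l
      doubled {e} e∈ root bounds with C₁ , C₂ , refl ← ∈-∃++ e∈ with ≤1 , rest ← bounds refl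
        = null-doubled C₁ e C₂ p wC (simple⇒unique simple)
            (3∸k≤1 (mult e l) (≤-trans (≤-reflexive (sym (weight-root root))) ≤1)) (λ b b∈ → weight-0 b (rest b b∈))
        where
        3∸k≤1 : ∀ k → 3 ∸ k ≤ 1 → 2 ≤ k
        3∸k≤1 zero          (s≤s ())
        3∸k≤1 (suc zero)    (s≤s ())
        3∸k≤1 (suc (suc k)) _ = s≤s (s≤s z≤n)
      light : Dec _ → Null l
      light (yes heavy) with e , e∈ , 1≤ ← find heavy = doubled e∈ (weight-≥1 1≤) bounds
        where
        bounds : ∀ {C₁ C₂} → C ≡ C₁ ++ e ∷ C₂ → weight e ≤ 1 × (∀ b → b ∈ C₁ ++ C₂ → weight b ≡ 0)
        bounds {C₁} {C₂} refl = ≤-trans (m≤m+n _ _) total≤ ,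
          -- `e` exhausts the total of 1, which leaves weight 0 for the rest of the cycle.
          λ b b∈ → n≤0⇒n≡0 (≤-trans (∈⇒≤sum weight b∈) (s≤s⁻¹ (≤-trans (+-monoˡ-≤ _ 1≤) total≤)))
          where
          total≤ : weight e + sum (map weight (C₁ ++ C₂)) ≤ 1
          total≤ = ≤-trans (≤-reflexive (sum-↭ (↭-map⁺ weight (↭-sym (shift e C₁ C₂))))) (s≤s⁻¹ (≰⇒> 2≰))
      -- All weights are 0, but only for an arrow into a root does this guarantee the two
      -- occurrences needed to start, so `e` is chosen at a root.
      light (no ¬heavy) with e , e∈ , root ← cycle-has-root p wC ne ⊆l =
        doubled e∈ root λ { {C₁} {C₂} refl →
          ≤-trans (≤-reflexive (weightless e∈)) z≤n ,
          λ b b∈ → weightless (∈-resp-↭ (↭-sym (shift e C₁ C₂)) (there b∈)) }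
        where
        weightless : ∀ {b} → b ∈ C → weight b ≡ 0
        weightless b∈ = n<1⇒n≡0 (≰⇒> λ 1≤ → ¬heavy (Any.map (λ { refl → 1≤ }) b∈))

    weight-total : sum (map weight l) ≤ sum (map (λ a → ρ (head a) * 2) (allFin d))
    weight-total = begin
      sum (map weight l)                                       ≡⟨ sum-by-fibre (λ a → a) weight l ⟩
      ∑ (λ a → mult a l * weight a)                            ≤⟨ ∑-mono-≤ (λ a → bound (mult a l) (ρ (head a))) ⟩
      ∑ (λ a → ρ (head a) * 2)                                 ≡⟨ ∑-allFin (λ a → ρ (head a) * 2) ⟩
      sum (map (λ a → ρ (head a) * 2) (allFin d))              ∎
      where
      open ≤-Reasoning
      k*[3∸k]≤2 : ∀ k → k * (3 ∸ k) ≤ 2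
      k*[3∸k]≤2 zero                = z≤n
      k*[3∸k]≤2 (suc zero)          = ≤-refl
      k*[3∸k]≤2 (suc (suc zero))    = ≤-refl
      k*[3∸k]≤2 (suc (suc (suc k))) = ≤-trans (≤-reflexive (trans (cong (suc (suc (suc k)) *_) (0∸n≡0 k)) (*-zeroʳ k))) z≤n
      bound : ∀ k r → k * (r * (3 ∸ k)) ≤ r * 2
      bound k r = ≤-trans (≤-reflexive (x∙yz≈y∙xz k r (3 ∸ k))) (*-monoʳ-≤ r (k*[3∸k]≤2 k))

    -- The estimate holds vertex by vertex. For indegree i it reads 4 ≤ 4 i off the roots and 2 i +
    -- 4 ≤ 4 i at a root with i ≥ 2. At `v₀`, where i may be 1, a deficit of 2 is possible, whence
    -- the final `+ 2`. Keeping `n * 4` on the left avoids truncated subtraction.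
    root-count : (∀ v → 1 ≤ indeg v) →
                 sum (map (λ a → ρ (head a) * 2) (allFin d)) + n * 4 ≤ d * 4 + 2
    root-count indeg≥1 = begin
      sum (map (λ a → ρ (head a) * 2) (allFin d)) + n * 4
        ≡⟨ cong₂ _+_ (sum-by-fibre head (λ v → ρ v * 2) (allFin d)) (sym (∑-const n 4)) ⟩
      ∑ (λ v → indeg v * (ρ v * 2)) + ∑ {n} (λ _ → 4)
        ≡⟨ ∑-distrib-+ (λ v → indeg v * (ρ v * 2)) (λ _ → 4) ⟨
      ∑ (λ v → indeg v * (ρ v * 2) + 4)
        ≤⟨ ∑-mono-≤ (λ v → local v (indeg≥1 v)) ⟩
      ∑ (λ v → indeg v * 4 + mult v [ v₀ ] * 2)
        ≡⟨ ∑-distrib-+ (λ v → indeg v * 4) (λ v → mult v [ v₀ ] * 2) ⟩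
      ∑ (λ v → indeg v * 4) + ∑ (λ v → mult v [ v₀ ] * 2)
        ≡⟨ cong₂ _+_ (sym (sum-by-fibre head (λ _ → 4) (allFin d))) (∑-select (λ _ → 2) v₀) ⟩
      sum (map (λ _ → 4) (allFin d)) + 2
        ≡⟨ cong (_+ 2) (trans (sym (∑-allFin {d} (λ _ → 4))) (∑-const d 4)) ⟩
      d * 4 + 2 ∎
      where
      open ≤-Reasoning
      split : ∀ k → k * 4 ≡ k * 2 + k * 2
      split k = *-distribˡ-+ k 2 2
      local : ∀ v → 1 ≤ indeg v → indeg v * (ρ v * 2) + 4 ≤ indeg v * 4 + mult v [ v₀ ] * 2
      local v 1≤ with root? v
      ... | no _ = ≤-trans (≤-reflexive (cong (_+ 4) (*-zeroʳ (indeg v))))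
                     (≤-trans (*-monoˡ-≤ 4 1≤) (m≤m+n _ _))
      ... | yes (inj₂ 2≤) = ≤-trans (+-monoʳ-≤ (indeg v * 2) (*-monoˡ-≤ 2 2≤))
                              (≤-trans (≤-reflexive (sym (split (indeg v)))) (m≤m+n _ _))
      ... | yes (inj₁ refl) = begin
        indeg v * 2 + 4                     ≡⟨ +-assoc (indeg v * 2) 2 2 ⟨
        indeg v * 2 + 2 + 2                 ≤⟨ +-monoˡ-≤ 2 (+-monoʳ-≤ (indeg v * 2) (*-monoˡ-≤ 2 1≤)) ⟩
        indeg v * 2 + indeg v * 2 + 2       ≡⟨ cong₂ _+_ (sym (split (indeg v))) (sym (cong (_* 2) (mult-self v []))) ⟩
        indeg v * 4 + mult v [ v ] * 2      ∎

  -- Counting the primitive cycles of a nonzero closed path.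

  degree-bound : StronglyConnected Q → ∀ m → (∀ {v} (p : Path Q v v) → Primitive p → deg p ≤ m) →
                 ∀ (h : ClosedPath Q) → ¬ h ≋0 → degree h + 2 * m * n ≤ 2 * m * d + m
  degree-bound connected m deg≤m (v , h) h≢0
    with Cs , cycles , perm ← cycle-decomposition (deg h) (arrows h) ≤-refl (arrows-nonempty h) (fromPath h)
    = begin
    deg h + 2 * m * n                         ≡⟨ cong (_+ 2 * m * n) (↭-length perm) ⟨
    length (concat Cs) + 2 * m * n            ≤⟨ +-monoˡ-≤ _ (length-concat-≤ (All.map cycle-length cycles)) ⟩
    length Cs * m + 2 * m * n                 ≡⟨ factor (length Cs) n m ⟩
    m * (length Cs + n * 2)                   ≤⟨ *-monoʳ-≤ m (number≤ Cs cycles perm) ⟩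
    m * (d * 2 + 1)                           ≡⟨ expand d m ⟩
    2 * m * d + m                             ∎
    where
    open ≤-Reasoning
    l : List (Fin d)
    l = arrows h
    factor : ∀ k n m → k * m + 2 * m * n ≡ m * (k + n * 2)
    factor = ℕ-solve.solve-∀
    expand : ∀ d m → m * (d * 2 + 1) ≡ 2 * m * d + m
    expand = ℕ-solve.solve-∀
    cycle-length : ∀ {C} → Cycle C → length C ≤ m
    cycle-length {[]}    (_ , ne , _) = contradiction refl ne
    cycle-length {a ∷ C} (simple , _ , _ , p) with q , eq ← toPath a C p =
      subst (λ l → length l ≤ m) eq (deg≤m q (simple⇒primitive q (subst Simple (sym eq) simple)))
    number≤ : ∀ Cs → All Cycle Cs → concat Cs ↭ l → length Cs + n * 2 ≤ d * 2 + 1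
    -- Each cycle weighs at least 2, so comparing weights bounds twice the number of cycles.
    number≤ Cs cycles perm = *-cancelʳ-≤ _ _ 2 (begin
      (length Cs + n * 2) * 2
        ≡⟨ double (length Cs) n ⟩
      length Cs * 2 + n * 4
        ≤⟨ +-monoˡ-≤ (n * 4) (sum-map-concat-≥ (weight v l) heavy) ⟩
      sum (map (weight v l) (concat Cs)) + n * 4
        ≡⟨ cong (_+ n * 4) (sum-↭ (↭-map⁺ (weight v l) perm)) ⟩
      sum (map (weight v l) l) + n * 4
        ≤⟨ +-monoˡ-≤ (n * 4) (weight-total v l) ⟩
      sum (map (λ a → ρ v l (head a) * 2) (allFin d)) + n * 4
        ≤⟨ root-count v l (stronglyConnected⇒indeg≥1 connected) ⟩
      d * 4 + 2
        ≡⟨ halve d ⟩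
      (d * 2 + 1) * 2 ∎)
      where
      double : ∀ k n → (k + n * 2) * 2 ≡ k * 2 + n * 4
      double = ℕ-solve.solve-∀
      halve : ∀ d → d * 4 + 2 ≡ (d * 2 + 1) * 2
      halve = ℕ-solve.solve-∀
      heavy : All (λ C → 2 ≤ sum (map (weight v l) C)) Cs
      heavy = All.tabulate λ C∈ → cycle-weight v l (fromPath h) (λ z → h≢0 (z (v , h) refl))
                (All.lookup cycles C∈) (λ a∈ → ∈-resp-↭ perm (∈-concat⁺′ a∈ C∈))

-- Passage to the integers.

open import Data.Integer using (+_; _+_; _-_; _*_; _≤_)

-- The subtraction-free inequality of naturals is embedded, and the term in `n` is moved to the
-- right.
difference-bound : ∀ k m n d → k ℕ.+ 2 ℕ.* m ℕ.* n ℕ.≤ 2 ℕ.* m ℕ.* d ℕ.+ m →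
                   + k ≤ + 2 * + m * (+ d - + n) + + m
difference-bound k m n d k≤ = begin
  + k                                        ≡⟨ add-sub (+ k) (+ m) (+ n) ⟩
  (+ k + + 2 * + m * + n) - + 2 * + m * + n  ≤⟨ ℤ.+-monoˡ-≤ (ℤ.- (+ 2 * + m * + n)) (subst₂ _≤_ (embed₁ k m n) (embed₂ m d) (ℤ.+≤+ k≤)) ⟩
  (+ 2 * + m * + d + + m) - + 2 * + m * + n  ≡⟨ collect (+ m) (+ d) (+ n) ⟩
  + 2 * + m * (+ d - + n) + + m              ∎
  where
  open ℤ.≤-Reasoning
  product₂ : ∀ m n → + (2 ℕ.* m ℕ.* n) ≡ + 2 * + m * + n
  product₂ m n = trans (ℤ.pos-* (2 ℕ.* m) n) (cong (_* + n) (ℤ.pos-* 2 m))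
  embed₁ : ∀ k m n → + (k ℕ.+ 2 ℕ.* m ℕ.* n) ≡ + k + + 2 * + m * + n
  embed₁ k m n = cong (λ i → + k + i) (product₂ m n)
  embed₂ : ∀ m d → + (2 ℕ.* m ℕ.* d ℕ.+ m) ≡ + 2 * + m * + d + + m
  embed₂ m d = cong (_+ + m) (product₂ m d)
  add-sub : ∀ k m n → k ≡ (k + + 2 * m * n) - + 2 * m * n
  add-sub = ℤ-solve.solve-∀
  collect : ∀ m d n → (+ 2 * m * d + m) - + 2 * m * n ≡ + 2 * m * (d - n) + m
  collect = ℤ-solve.solve-∀

theorem6p2 : ∀ {c ℓ₁ ℓ₂ : Level} (K : HeytingField c ℓ₁ ℓ₂) →
    Infinite K → HasCharacteristic2 K →
    ∀ (n d m : ℕ) (Q : 𝒬 n d m) (h : ClosedPath (𝒬.quiver Q)) →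
    ¬ (h ≋0) →
    + degree h ≤ + 2 * + m * (+ d - + n) + + m
theorem6p2 K _ _ n d m Q h h≢0 =
  difference-bound (degree h) m n d
    (degree-bound stronglyConnected m (proj₂ maxPrimitiveDegree) h h≢0)
  where open 𝒬 Q
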